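{- Let $B$ be a $p\times q$ matrix, $G$ a $q\times q$ symmetric matrix and $G'$ a $p\times p$ symmetric matrix, and let $E,F$ be $q\times q$ symmetric matrices with $E+F=G$. Let $$A=\begin{bmatrix} G' & B & B\\ B^T & 0 & G\\ B^T & G & 0\end{bmatrix},\qquad D=\begin{bmatrix} G' & B & B\\ B^T & E & F\\ B^T & F & E\end{bmatrix},$$ both of size $(p+2q)\times(p+2q)$. Then $A\oplus\begin{bmatrix} E & F\\ F & E\end{bmatrix}$ and $D\oplus\begin{bmatrix}0 & G\\ G & 0\end{bmatrix}$ are cospectral.
   Context: For matrices $X,Y$, $X\oplus Y=\begin{bmatrix} X&0\\0&Y\end{bmatrix}$, and $0$ denotes a zero matrix of appropriate size. Two square matrices are cospectral if they have the same eigenvalues with the same multiplicities. -}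

module Defs where

open import Algebra.Apartness.Bundles using (HeytingField; HeytingCommutativeRing)
open import Algebra.Bundles using (CommutativeRing)
open import Algebra.Bundles.Raw using (RawRing)
import Algebra.Definitions.RawSemiring as RawSemiringDefinitions
open import Algebra.Morphism.Structures using (module RingMorphisms)
open import Data.Bool.Base using (if_then_else_)
open import Data.Fin.Base using (Fin; zero; suc; toℕ; punchIn)
open import Data.Fin.Properties using (_≟_)
open import Data.List.Base using (List; []; _∷_; map)
open import Data.Nat.Base as ℕ using (ℕ; zero; suc)
open import Data.Product.Base using (Σ-syntax; _×_)
open import Data.Vec.Functional using (Vector; _++_)
open import Function.Bundles using (_⇔_)
open import Level using (Level; _⊔_) renaming (suc to lsuc)
open import Relation.Nullary.Decidable.Core using (does)

private
  variable
    a c ℓ ℓ₁ ℓ₂ : Level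
    A : Set a
    m n p q : ℕ

Matrix : Set a → ℕ → ℕ → Set a
Matrix A m n = Vector (Vector A n) m

block : Matrix A m n → Matrix A m q → Matrix A p n → Matrix A p q →
        Matrix A (m ℕ.+ p) (n ℕ.+ q)
block X Y Z W = (λ i → X i ++ Y i) ++ (λ i → Z i ++ W i)

module _ (R : RawRing c ℓ) where
  open RawRing R
  open RawSemiringDefinitions rawSemiring using (sum; _^_)

  zeroMatrix : Matrix Carrier m n
  zeroMatrix _ _ = 0#

  directSum : Matrix Carrier m m → Matrix Carrier n n →
              Matrix Carrier (m ℕ.+ n) (m ℕ.+ n)
  directSum X Y = block X zeroMatrix zeroMatrix Y

  Symmetric : Matrix Carrier n n → Set ℓ
  Symmetric M = ∀ i j → M i j ≈ M j i

  -- Laplace expansion along the first row.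
  det : ∀ {n} → Matrix Carrier n n → Carrier
  det {zero}  M = 1#
  det {suc n} M =
    sum (λ j → (- 1#) ^ toℕ j * (M zero j * det (λ i k → M (suc i) (punchIn j k))))

  -- A polynomial is its list of coefficients, constant term first; trailing
  -- zeros are allowed and are ignored by the equality.
  Poly : Set c
  Poly = List Carrier

  coeff : Poly → ℕ → Carrier
  coeff []      _       = 0#
  coeff (x ∷ _) zero    = x
  coeff (_ ∷ f) (suc n) = coeff f n

  infixl 6 _+ₚ_
  infixl 7 _*ₚ_

  _+ₚ_ : Poly → Poly → Poly
  []      +ₚ g       = g
  (x ∷ f) +ₚ []      = x ∷ f
  (x ∷ f) +ₚ (y ∷ g) = (x + y) ∷ (f +ₚ g)

  _*ₚ_ : Poly → Poly → Poly
  []      *ₚ g = []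
  (x ∷ f) *ₚ g = map (x *_) g +ₚ (0# ∷ (f *ₚ g))

  polyRawRing : RawRing c ℓ
  polyRawRing = record
    { Carrier = Poly
    ; _≈_     = λ f g → ∀ n → coeff f n ≈ coeff g n
    ; _+_     = _+ₚ_
    ; _*_     = _*ₚ_
    ; -_      = map (-_)
    ; 0#      = []
    ; 1#      = 1# ∷ []
    }

  eval : Poly → Carrier → Carrier
  eval []      x = 0#
  eval (y ∷ f) x = y + x * eval f x

  -- The matrix X·I − M over the polynomial ring.
  charMatrix : Matrix Carrier n n → Matrix Poly n n
  charMatrix M i j = (if does (i ≟ j) then 0# ∷ 1# ∷ [] else []) +ₚ (- M i j ∷ [])

charPoly : (R : RawRing c ℓ) → Matrix (RawRing.Carrier R) n n → Poly R
charPoly R M = det (polyRawRing R) (charMatrix R M)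

fieldRawRing : HeytingField c ℓ₁ ℓ₂ → RawRing c ℓ₁
fieldRawRing K = CommutativeRing.rawRing
  (HeytingCommutativeRing.commutativeRing (HeytingField.heytingCommutativeRing K))

-- μ is a root of the characteristic polynomial of multiplicity exactly k, i.e.
-- charPoly M = (X − μ)ᵏ g with g(μ) ≠ 0; k = 0 says that μ is not an eigenvalue.
EigenvalueMultiplicity : (K : HeytingField c ℓ₁ ℓ₂) → let open HeytingField K in
  Matrix Carrier n n → Carrier → ℕ → Set (c ⊔ ℓ₁ ⊔ ℓ₂)
EigenvalueMultiplicity K M μ k =
  Σ[ g ∈ Poly R ] (charPoly R M ≈ₚ ((- μ ∷ 1# ∷ []) ^ₚ k) *ₚ′ g) × (eval R g μ # 0#)
  where
  open HeytingField K using (-_; 1#; 0#; _#_)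
  R = fieldRawRing K
  open RawRing (polyRawRing R) using () renaming (_≈_ to _≈ₚ_; _*_ to _*ₚ′_)
  open RawSemiringDefinitions (RawRing.rawSemiring (polyRawRing R)) using () renaming (_^_ to _^ₚ_)

-- The eigenvalues are taken in arbitrary extension fields L of K, so that the
-- notion is the usual one also when K does not contain all of them.
Cospectral : (K : HeytingField c ℓ₁ ℓ₂) → let open HeytingField K in
  Matrix Carrier n n → Matrix Carrier n n → Set (lsuc (c ⊔ ℓ₁ ⊔ ℓ₂))
Cospectral {c} {ℓ₁} {ℓ₂} K M N =
  (L : HeytingField c ℓ₁ ℓ₂) (φ : HeytingField.Carrier K → HeytingField.Carrier L) →
  RingMorphisms.IsRingHomomorphism (fieldRawRing K) (fieldRawRing L) φ →
  ∀ μ k → EigenvalueMultiplicity L (λ i j → φ (M i j)) μ k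
        ⇔ EigenvalueMultiplicity L (λ i j → φ (N i j)) μ k

{-# OPTIONS --safe #-}

-- Over any commutative ring, subtracting the second block column of
-- [[a, b, b], [c, e, f], [c, f, e]] from the third and then adding the third block
-- row to the second gives [[a, b, 0], [2c, e+f, 0], [c, f, e-f]]. Hence the
-- determinant is det [[a, b], [2c, e+f]] · det (e-f), where the first factor depends
-- on e and f only through e+f. Apply this over the polynomial ring to the four
-- characteristic matrices (the 2×2 block ones being the case p = 0): e+f = X − G in
-- all of them, so both products consist of the same four factors.

module Submission where

open import Defs
open import Algebra.Apartness.Bundles using (HeytingField; HeytingCommutativeRing)
open import Algebra.Bundles using (CommutativeRing)
open import Algebra.Bundles.Raw using (RawRing)
open import Algebra.Morphism.Structures using (module RingMorphisms)
open import Data.Bool.Base using (if_then_else_)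
open import Data.Fin.Base using (Fin; zero; suc; toℕ; fromℕ<; punchIn; cast; splitAt; join; _↑ˡ_; _↑ʳ_)
open import Data.Fin.Properties using (_≟_; <-cmp; cast-is-id; join-splitAt; splitAt-↑ˡ; splitAt-↑ʳ; suc-injective; toℕ-fromℕ<; toℕ-injective; toℕ-↑ˡ; toℕ<n)
open import Data.List.Base using ([]; _∷_; map)
open import Data.Nat.Base as ℕ using (ℕ; zero; suc)
import Data.Nat.Properties as ℕ
open import Data.Product.Base using (∃-syntax; _×_; _,_)
open import Data.Sum.Base using (_⊎_; inj₁; inj₂; assocʳ; map₁; map₂)
open import Data.Sum.Properties using (≡-dec)
open import Data.Vec.Functional using (Vector; _++_; transpose; updateAt) renaming (_∷_ to infixr 5 _◂_)
open import Data.Vec.Functional.Properties using (updateAt-updates; updateAt-minimal)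
open import Function.Base using (_∘_; const; flip)
open import Function.Bundles using (mk⇔)
open import Level using (Level)
open import Relation.Binary.Definitions using (tri<; tri≈; tri>)
open import Relation.Binary.PropositionalEquality as ≡ using (_≡_; _≢_)
open import Relation.Nullary.Decidable using (does; does-⇔; yes; no)
open import Relation.Nullary.Negation using (contradiction)

-- Block diagonalising the twin blocks by a change of basis would use the vectors (x, x) and (x, -x)
-- scaled by 1/√2. Unscaled additions of rows and columns need no division by 2, so fields of
-- characteristic two are covered; the price is the block `2c`, which is the same for both pairs
-- `(e , f)`. The determinant is defined by Laplace expansion along the first row, so additivity,
-- transposition, alternation and the block triangular product all have to come out of that
-- recursion. Two bracketings of the index compete: the matrices of the theorem are nested as
-- `p + (q + q)`, while the triangular form is cut after `p + q`. The operations are therefore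
-- described on the sum type `Fin p ⊎ (Fin q ⊎ Fin q)`, which is neutral between the two. What is
-- established is equality of characteristic polynomials, with the entries already mapped into the
-- extension `L`; this yields all multiplicities at once and avoids comparing `charPoly` over `K`
-- with `charPoly` over `L`.

private
  variable
    a b : Level
    m n : ℕ

-- Index arithmetic of block matrices

punchIn-↑ˡ-↑ˡ : ∀ (j : Fin (suc m)) (k : Fin m) n → punchIn (j ↑ˡ n) (k ↑ˡ n) ≡ punchIn j k ↑ˡ n
punchIn-↑ˡ-↑ˡ zero    k       n = ≡.refl
punchIn-↑ˡ-↑ˡ (suc j) zero    n = ≡.refl
punchIn-↑ˡ-↑ˡ (suc j) (suc k) n = ≡.cong suc (punchIn-↑ˡ-↑ˡ j k n)

-- Deleting a column of the left block merely shifts the right block. With the previous lemma this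
-- identifies the blocks of a minor in `det-lowerTriangular`.
punchIn-↑ˡ-↑ʳ : ∀ (j : Fin (suc m)) (k : Fin n) → punchIn (j ↑ˡ n) (m ↑ʳ k) ≡ suc m ↑ʳ k
punchIn-↑ˡ-↑ʳ             zero    k = ≡.refl
punchIn-↑ˡ-↑ʳ {m = suc m} (suc j) k = ≡.cong suc (punchIn-↑ˡ-↑ʳ j k)

-- `split₃` follows the nesting of the blocks in the theorem, `split₃′` the cut between the first
-- two block rows and the third that the triangular form requires.
split₃ : ∀ p q → Fin (p ℕ.+ (q ℕ.+ q)) → Fin p ⊎ (Fin q ⊎ Fin q)
split₃ p q = map₂ (splitAt q) ∘ splitAt p

split₃′ : ∀ p q → Fin ((p ℕ.+ q) ℕ.+ q) → Fin p ⊎ (Fin q ⊎ Fin q)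
split₃′ p q = assocʳ ∘ map₁ (splitAt p) ∘ splitAt (p ℕ.+ q)

split₃-cast : ∀ p q i → split₃ p q (cast (ℕ.+-assoc p q q) i) ≡ split₃′ p q i
split₃-cast zero q i rewrite cast-is-id (ℕ.+-assoc zero q q) i with splitAt q i
... | inj₁ _ = ≡.refl
... | inj₂ _ = ≡.refl
split₃-cast (suc p) q zero    = ≡.refl
split₃-cast (suc p) q (suc i) = begin
  map₂ (splitAt q) (map₁ suc (splitAt p i′))                ≡⟨ suc-split (splitAt p i′) ⟩
  map₁ suc (split₃ p q i′)                                  ≡⟨ ≡.cong (map₁ suc) (split₃-cast p q i) ⟩
  map₁ suc (split₃′ p q i)                                  ≡⟨ suc-split′ (splitAt (p ℕ.+ q) i) ⟨
  assocʳ (map₁ (splitAt (suc p)) (map₁ suc (splitAt (p ℕ.+ q) i))) ∎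
  where
  open ≡.≡-Reasoning
  i′ = cast (ℕ.+-assoc p q q) i

  suc-split : ∀ x → map₂ (splitAt q) (map₁ suc x) ≡ map₁ suc (map₂ (splitAt q) x)
  suc-split (inj₁ _) = ≡.refl
  suc-split (inj₂ _) = ≡.refl

  suc-split′ : ∀ x → assocʳ (map₁ (splitAt (suc p)) (map₁ suc x)) ≡
                     map₁ suc (assocʳ (map₁ (splitAt p) x))
  suc-split′ (inj₁ k) with splitAt p k
  ... | inj₁ _ = ≡.refl
  ... | inj₂ _ = ≡.refl
  suc-split′ (inj₂ _) = ≡.refl

join₃′ : ∀ p q → Fin p ⊎ (Fin q ⊎ Fin q) → Fin ((p ℕ.+ q) ℕ.+ q)
join₃′ p q (inj₁ i)        = (i ↑ˡ q) ↑ˡ q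
join₃′ p q (inj₂ (inj₁ i)) = (p ↑ʳ i) ↑ˡ q
join₃′ p q (inj₂ (inj₂ i)) = (p ℕ.+ q) ↑ʳ i

split₃′-join₃′ : ∀ p q x → split₃′ p q (join₃′ p q x) ≡ x
split₃′-join₃′ p q (inj₁ i)
  rewrite splitAt-↑ˡ (p ℕ.+ q) (i ↑ˡ q) q | splitAt-↑ˡ p i q = ≡.refl
split₃′-join₃′ p q (inj₂ (inj₁ i))
  rewrite splitAt-↑ˡ (p ℕ.+ q) (p ↑ʳ i) q | splitAt-↑ʳ p q i = ≡.refl
split₃′-join₃′ p q (inj₂ (inj₂ i))
  rewrite splitAt-↑ʳ (p ℕ.+ q) q i = ≡.refl

-- Determinants over a commutative ring

module Determinant {c ℓ} (S : CommutativeRing c ℓ) where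
  open CommutativeRing S hiding (zero)
  open import Algebra.Properties.Semiring.Sum semiring
  open import Algebra.Properties.Semiring.Exp semiring using (_^_)
  open import Algebra.Solver.Ring.NaturalCoefficients.Default commutativeSemiring
    using (solve; _:*_; _:=_)
  open import Relation.Binary.Reasoning.Setoid setoid

  infix 4 _≋_

  ∣_∣ : Matrix Carrier n n → Carrier
  ∣_∣ = det rawRing

  _≋_ : {I : Set a} (u v : I → Carrier) → Set _
  u ≋ v = ∀ i → u i ≈ v i

  ≋-refl : {I : Set a} {u : I → Carrier} → u ≋ u
  ≋-refl _ = refl

  sign : Fin n → Carrier
  sign j = (- 1#) ^ toℕ j

  minor : Matrix Carrier (suc n) (suc n) → Fin (suc n) → Matrix Carrier n n
  minor M j i k = M (suc i) (punchIn j k)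

  sum-zero : {t : Vector Carrier n} → (∀ i → t i ≈ 0#) → sum t ≈ 0#
  sum-zero {n} t≈0 = trans (sum-cong-≋ t≈0) (sum-replicate-zero n)

  sum-++ : ∀ m (t : Vector Carrier (m ℕ.+ n)) → sum t ≈ sum (t ∘ (_↑ˡ n)) + sum (t ∘ (m ↑ʳ_))
  sum-++ zero    t = sym (+-identityˡ _)
  sum-++ (suc m) t = trans (+-congˡ (sum-++ m (t ∘ suc))) (sym (+-assoc _ _ _))

  det-cong : {M N : Matrix Carrier n n} → (∀ i → M i ≋ N i) → ∣ M ∣ ≈ ∣ N ∣
  det-cong {zero}  M≋N = refl
  det-cong {suc n} M≋N = sum-cong-≋ λ j →
    *-congˡ {x = sign j} (*-cong (M≋N zero j) (det-cong λ i k → M≋N (suc i) (punchIn j k)))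

  det-cast : (eq : m ≡ n) (M : Matrix Carrier n n) →
             ∣ (λ i j → M (cast eq i) (cast eq j)) ∣ ≈ ∣ M ∣
  det-cast ≡.refl M = det-cong λ i j →
    reflexive (≡.cong₂ M (cast-is-id ≡.refl i) (cast-is-id ≡.refl j))

  det-minors-zero : (M : Matrix Carrier (suc n) (suc n)) →
                    (∀ j → ∣ minor M j ∣ ≈ 0#) → ∣ M ∣ ≈ 0#
  det-minors-zero M minors≈0 = sum-zero λ j → trans
    (*-congˡ {x = sign j} (trans (*-congˡ {x = M zero j} (minors≈0 j)) (zeroʳ _))) (zeroʳ _)

  laplaceTerm : Matrix Carrier (suc n) (suc n) → Vector Carrier (suc n)
  laplaceTerm M j = sign j * (M zero j * ∣ minor M j ∣)

  -- For row 0 the entries in the expansion split and the minors agree; for a later row the entries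
  -- agree and the minors split by induction.
  det-additive : ∀ r {M N P : Matrix Carrier n n} →
                 (∀ i → i ≢ r → P i ≋ M i) → (∀ i → i ≢ r → P i ≋ N i) →
                 (∀ k → P r k ≈ M r k + N r k) → ∣ P ∣ ≈ ∣ M ∣ + ∣ N ∣
  det-additive {suc n} zero {M} {N} {P} P≋M P≋N Pr =
    trans (sum-cong-≋ term) (∑-distrib-+ (laplaceTerm M) (laplaceTerm N))
    where
    term : ∀ j → laplaceTerm P j ≈ laplaceTerm M j + laplaceTerm N j
    term j = begin
      sign j * (P zero j * ∣ minor P j ∣)
        ≈⟨ *-congˡ (trans (*-congʳ (Pr j)) (distribʳ _ _ _)) ⟩
      sign j * (M zero j * ∣ minor P j ∣ + N zero j * ∣ minor P j ∣)
        ≈⟨ distribˡ _ _ _ ⟩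
      sign j * (M zero j * ∣ minor P j ∣) + sign j * (N zero j * ∣ minor P j ∣)
        ≈⟨ +-cong (*-congˡ (*-congˡ (det-cong λ i k → P≋M (suc i) (λ ()) (punchIn j k))))
                  (*-congˡ (*-congˡ (det-cong λ i k → P≋N (suc i) (λ ()) (punchIn j k)))) ⟩
      laplaceTerm M j + laplaceTerm N j ∎
  det-additive {suc n} (suc r) {M} {N} {P} P≋M P≋N Pr =
    trans (sum-cong-≋ term) (∑-distrib-+ (laplaceTerm M) (laplaceTerm N))
    where
    minor-additive : ∀ j → ∣ minor P j ∣ ≈ ∣ minor M j ∣ + ∣ minor N j ∣
    minor-additive j = det-additive r
      (λ i i≢r k → P≋M (suc i) (i≢r ∘ suc-injective) (punchIn j k))
      (λ i i≢r k → P≋N (suc i) (i≢r ∘ suc-injective) (punchIn j k))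
      (λ k → Pr (punchIn j k))

    term : ∀ j → laplaceTerm P j ≈ laplaceTerm M j + laplaceTerm N j
    term j = begin
      sign j * (P zero j * ∣ minor P j ∣)
        ≈⟨ *-congˡ (trans (*-congˡ (minor-additive j)) (distribˡ _ _ _)) ⟩
      sign j * (P zero j * ∣ minor M j ∣ + P zero j * ∣ minor N j ∣)
        ≈⟨ distribˡ _ _ _ ⟩
      sign j * (P zero j * ∣ minor M j ∣) + sign j * (P zero j * ∣ minor N j ∣)
        ≈⟨ +-cong (*-congˡ (*-congʳ (P≋M zero (λ ()) j))) (*-congˡ (*-congʳ (P≋N zero (λ ()) j))) ⟩
      laplaceTerm M j + laplaceTerm N j ∎

  -- Rows 0 and `suc i` and columns 0 and `suc j` are deleted. The remaining matrix appears
  -- transposed because a column expansion of the minor is obtained as the row expansion of its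
  -- transpose. The corner entry, lying in row 0 and column 0 at once, stays outside this double
  -- sum.
  doubleTerm : Matrix Carrier (suc (suc n)) (suc (suc n)) → Fin (suc n) → Fin (suc n) → Carrier
  doubleTerm M j i = sign (suc j) * (M zero (suc j) *
    (sign i * (M (suc i) zero * ∣ (λ k l → M (suc (punchIn i l)) (suc (punchIn j k))) ∣)))

  -- The hypothesis is the induction hypothesis of `det-transpose` for this minor.
  expand-minor : (M : Matrix Carrier (suc (suc n)) (suc (suc n))) (j : Fin (suc n)) →
                 ∣ transpose (minor M (suc j)) ∣ ≈ ∣ minor M (suc j) ∣ →
                 sign (suc j) * (M zero (suc j) * ∣ minor M (suc j) ∣) ≈ sum (doubleTerm M j)
  expand-minor {n} M j transpose-minor = begin
    sign (suc j) * (M zero (suc j) * ∣ minor M (suc j) ∣)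
      ≈⟨ *-congˡ (*-congˡ transpose-minor) ⟨
    sign (suc j) * (M zero (suc j) * sum column)
      ≈⟨ *-congˡ (*-distribˡ-sum (M zero (suc j)) column) ⟩
    sign (suc j) * sum (λ i → M zero (suc j) * column i)
      ≈⟨ *-distribˡ-sum (sign (suc j)) (λ i → M zero (suc j) * column i) ⟩
    sum (doubleTerm M j) ∎
    where
    column : Vector Carrier (suc n)
    column i = sign i * (M (suc i) zero * ∣ (λ k l → M (suc (punchIn i l)) (suc (punchIn j k))) ∣)

  doubleTerm-transpose : (M : Matrix Carrier (suc (suc n)) (suc (suc n))) (i j : Fin (suc n)) →
    ∣ (λ k l → M (suc (punchIn j k)) (suc (punchIn i l))) ∣ ≈
    ∣ (λ k l → M (suc (punchIn j l)) (suc (punchIn i k))) ∣ →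
    doubleTerm (transpose M) j i ≈ doubleTerm M i j
  doubleTerm-transpose M i j eq = begin
    (- 1# * sign j) * (M (suc j) zero * (sign i * (M zero (suc i) * d′)))
      ≈⟨ *-congˡ (*-congˡ (*-congˡ (*-congˡ eq))) ⟩
    (- 1# * sign j) * (M (suc j) zero * (sign i * (M zero (suc i) * d)))
      -- The solver works over semirings, so `- 1#` enters as an opaque variable `u`.
      ≈⟨ solve 6 (λ s x t y u z → (u :* s) :* (x :* (t :* (y :* z))) := (u :* t) :* (y :* (s :* (x :* z))))
           refl (sign j) (M (suc j) zero) (sign i) (M zero (suc i)) (- 1#) d ⟩
    (- 1# * sign i) * (M zero (suc i) * (sign j * (M (suc j) zero * d))) ∎
    where
    d d′ : Carrier
    d  = ∣ (λ k l → M (suc (punchIn j l)) (suc (punchIn i k))) ∣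
    d′ = ∣ (λ k l → M (suc (punchIn j k)) (suc (punchIn i l))) ∣

  -- Expanding along the first row and then each remaining minor along its first
  -- column gives a double sum that is symmetric under transposition.
  det-transpose : (M : Matrix Carrier n n) → ∣ transpose M ∣ ≈ ∣ M ∣
  det-transpose {zero}        M = refl
  det-transpose {suc zero}    M = refl
  det-transpose {suc (suc n)} M = +-cong
    (*-congˡ {x = 1#} (*-congˡ (det-transpose (minor M zero)))) (begin
    sum (λ j → sign (suc j) * (M (suc j) zero * ∣ minor (transpose M) (suc j) ∣))
      ≈⟨ sum-cong-≋ (λ j → expand-minor (transpose M) j (det-transpose (minor (transpose M) (suc j)))) ⟩
    sum (λ j → sum (λ i → doubleTerm (transpose M) j i))
      ≈⟨ ∑-comm (doubleTerm (transpose M)) ⟩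
    sum (λ i → sum (λ j → doubleTerm (transpose M) j i))
      ≈⟨ sum-cong-≋ (λ i → sum-cong-≋ (λ j → doubleTerm-transpose M i j
           (det-transpose (λ k l → M (suc (punchIn j l)) (suc (punchIn i k)))))) ⟩
    sum (λ i → sum (doubleTerm M i))
      ≈⟨ sum-cong-≋ (λ j → expand-minor M j (det-transpose (minor M (suc j)))) ⟨
    sum (λ j → sign (suc j) * (M zero (suc j) * ∣ minor M (suc j) ∣)) ∎)

  -- The terms of columns 0 and 1 have equal entries and equal minors but opposite signs. Columns
  -- come before rows because the expansion runs along a row and deletes one column at a time.
  det-columns₀₁ : (M : Matrix Carrier (suc (suc n)) (suc (suc n))) →
                  (∀ i → M i zero ≈ M i (suc zero)) → ∣ M ∣ ≈ 0#
  det-columns₀₁ {n} M eq = begin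
    1# * (M₀ * d₀) + ((- 1# * 1#) * (M₁ * d₁) + rest)
      ≈⟨ +-congˡ (+-cong (*-congˡ (*-cong (eq zero) d₀≈d₁)) (sym (rest≈0 n M eq))) ⟨
    1# * (M₀ * d₀) + ((- 1# * 1#) * (M₀ * d₀) + 0#)    ≈⟨ +-congˡ (+-identityʳ _) ⟩
    1# * (M₀ * d₀) + (- 1# * 1#) * (M₀ * d₀)           ≈⟨ distribʳ _ _ _ ⟨
    (1# + - 1# * 1#) * (M₀ * d₀)                       ≈⟨ *-congʳ (trans (+-congˡ (*-identityʳ _)) (-‿inverseʳ 1#)) ⟩
    0# * (M₀ * d₀)                                     ≈⟨ zeroˡ _ ⟩
    0#                                                 ∎
    where
    M₀ M₁ d₀ d₁ rest : Carrier
    M₀ = M zero zero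
    M₁ = M zero (suc zero)
    d₀ = ∣ minor M zero ∣
    d₁ = ∣ minor M (suc zero) ∣
    rest = sum (λ j → sign (suc (suc j)) * (M zero (suc (suc j)) * ∣ minor M (suc (suc j)) ∣))

    d₀≈d₁ : d₀ ≈ d₁
    d₀≈d₁ = det-cong {M = minor M zero} {minor M (suc zero)} λ { i zero → sym (eq (suc i)) ; i (suc k) → refl }

    -- The size is an argument so that the empty sum of a 2×2 matrix can be split off; in a larger
    -- matrix, deleting a later column leaves the two equal columns in places 0 and 1.
    rest≈0 : ∀ n (M : Matrix Carrier (suc (suc n)) (suc (suc n))) →
             (∀ i → M i zero ≈ M i (suc zero)) →
             sum (λ j → sign (suc (suc j)) * (M zero (suc (suc j)) * ∣ minor M (suc (suc j)) ∣)) ≈ 0#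
    rest≈0 zero    M eq = refl
    rest≈0 (suc n) M eq = sum-zero λ j → trans
      (*-congˡ {x = sign (suc (suc j))} (trans
        (*-congˡ {x = M zero (suc (suc j))} (det-columns₀₁ (minor M (suc (suc j))) (eq ∘ suc)))
        (zeroʳ _)))
      (zeroʳ _)

  det-rows₀₁ : (M : Matrix Carrier (suc (suc n)) (suc (suc n))) →
               M zero ≋ M (suc zero) → ∣ M ∣ ≈ 0#
  det-rows₀₁ M eq = trans (sym (det-transpose M)) (det-columns₀₁ (transpose M) eq)

  -- Polarisation: with `u + v` in both rows the determinant vanishes, and of its four summands the
  -- two with a repeated row vanish as well.
  det-swap₀₁ : ∀ (u v : Vector Carrier (suc (suc n))) (T : Matrix Carrier n (suc (suc n))) →
               ∣ u ◂ v ◂ T ∣ + ∣ v ◂ u ◂ T ∣ ≈ 0#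
  det-swap₀₁ u v T = begin
    ∣ u ◂ v ◂ T ∣ + ∣ v ◂ u ◂ T ∣                   ≈⟨ +-cong (+-identityˡ _) (+-identityʳ _) ⟨
    (0# + ∣ u ◂ v ◂ T ∣) + (∣ v ◂ u ◂ T ∣ + 0#)     ≈⟨ +-cong (+-congʳ (repeated u)) (+-congˡ (repeated v)) ⟨
    (∣ u ◂ u ◂ T ∣ + ∣ u ◂ v ◂ T ∣) + (∣ v ◂ u ◂ T ∣ + ∣ v ◂ v ◂ T ∣)
      ≈⟨ +-cong (second u) (second v) ⟨
    ∣ u ◂ w ◂ T ∣ + ∣ v ◂ w ◂ T ∣                   ≈⟨ first ⟨
    ∣ w ◂ w ◂ T ∣                                   ≈⟨ repeated w ⟩
    0#                                              ∎
    where
    w : Vector Carrier _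
    w k = u k + v k

    repeated : ∀ x → ∣ x ◂ x ◂ T ∣ ≈ 0#
    repeated x = det-rows₀₁ (x ◂ x ◂ T) ≋-refl

    first : ∣ w ◂ w ◂ T ∣ ≈ ∣ u ◂ w ◂ T ∣ + ∣ v ◂ w ◂ T ∣
    first = det-additive zero {u ◂ w ◂ T} {v ◂ w ◂ T} {w ◂ w ◂ T}
      (λ { zero 0≢0 → contradiction ≡.refl 0≢0 ; (suc i) _ → ≋-refl })
      (λ { zero 0≢0 → contradiction ≡.refl 0≢0 ; (suc i) _ → ≋-refl })
      ≋-refl

    second : ∀ x → ∣ x ◂ w ◂ T ∣ ≈ ∣ x ◂ u ◂ T ∣ + ∣ x ◂ v ◂ T ∣
    second x = det-additive (suc zero) {x ◂ u ◂ T} {x ◂ v ◂ T} {x ◂ w ◂ T}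
      (λ { zero _ → ≋-refl ; (suc zero) 1≢1 → contradiction ≡.refl 1≢1 ; (suc (suc i)) _ → ≋-refl })
      (λ { zero _ → ≋-refl ; (suc zero) 1≢1 → contradiction ≡.refl 1≢1 ; (suc (suc i)) _ → ≋-refl })
      ≋-refl

  -- Equal rows r and s with 0 < r < s are equal rows of every minor; the case r = 0
  -- reduces to this one by exchanging rows 0 and 1.
  det-alternating-< : ∀ (M : Matrix Carrier n n) r s → toℕ r ℕ.< toℕ s → M r ≋ M s → ∣ M ∣ ≈ 0#
  det-alternating-< {suc (suc n)} M zero (suc zero) _ eq = det-rows₀₁ M eq
  det-alternating-< {suc (suc n)} M zero (suc (suc s)) _ eq = begin
    ∣ M ∣                            ≈⟨ det-cong {M = M} {u ◂ v ◂ T} (λ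
                                          { zero          → ≋-refl
                                          ; (suc zero)    → ≋-refl
                                          ; (suc (suc i)) → ≋-refl }) ⟩
    ∣ u ◂ v ◂ T ∣                    ≈⟨ +-identityʳ _ ⟨
    ∣ u ◂ v ◂ T ∣ + 0#               ≈⟨ +-congˡ (det-minors-zero (v ◂ u ◂ T) (λ j →
                                          det-alternating-< (minor (v ◂ u ◂ T) j) zero (suc s)
                                            (ℕ.s≤s ℕ.z≤n) (eq ∘ punchIn j))) ⟨
    ∣ u ◂ v ◂ T ∣ + ∣ v ◂ u ◂ T ∣    ≈⟨ det-swap₀₁ u v T ⟩
    0#                               ∎
    where
    u v : Vector Carrier (suc (suc n))
    u = M zero
    v = M (suc zero)
    T : Matrix Carrier n (suc (suc n))
    T i = M (suc (suc i))
  det-alternating-< {suc n} M (suc r) (suc s) r<s eq = det-minors-zero M λ j →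
    det-alternating-< (minor M j) r s (ℕ.s<s⁻¹ r<s) (eq ∘ punchIn j)

  det-alternating : ∀ (M : Matrix Carrier n n) {r s} → r ≢ s → M r ≋ M s → ∣ M ∣ ≈ 0#
  det-alternating M {r} {s} r≢s eq with <-cmp r s
  ... | tri< r<s _ _ = det-alternating-< M r s r<s eq
  ... | tri≈ _ r≡s _ = contradiction r≡s r≢s
  ... | tri> _ _ s<r = det-alternating-< M s r s<r (sym ∘ eq)

  -- Row and column additions

  det-addRow : ∀ {M P : Matrix Carrier n n} {r s} → r ≢ s → (∀ i → i ≢ r → P i ≋ M i) →
               (∀ k → P r k ≈ M r k + M s k) → ∣ P ∣ ≈ ∣ M ∣
  det-addRow {M = M} {P} {r} {s} r≢s P≋M Pr = begin
    ∣ P ∣          ≈⟨ det-additive r P≋M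
                       (λ i i≢r k → trans (P≋M i i≢r k) (reflexive (≡.cong (λ row → row k) (≡.sym (N-other i≢r)))))
                       (λ k → trans (Pr k) (+-congˡ (reflexive (≡.cong (λ row → row k) (≡.sym N-r))))) ⟩
    ∣ M ∣ + ∣ N ∣  ≈⟨ +-congˡ (det-alternating N r≢s λ k →
                       reflexive (≡.cong (λ row → row k) (≡.trans N-r (≡.sym (N-other (r≢s ∘ ≡.sym)))))) ⟩
    ∣ M ∣ + 0#     ≈⟨ +-identityʳ _ ⟩
    ∣ M ∣          ∎
    where
    N : Matrix Carrier _ _
    N = updateAt M r (const (M s))

    N-r : N r ≡ M s
    N-r = updateAt-updates r M

    N-other : ∀ {i} → i ≢ r → N i ≡ M i
    N-other i≢r = updateAt-minimal _ r M i≢r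

  -- P arises from M by adding, to some of the rows, a row that is itself left alone.
  AddsRows : {I : Set a} {J : Set b} (M P : I → J → Carrier) → Set _
  AddsRows M P = ∀ i → P i ≋ M i ⊎
    ∃[ j ] i ≢ j × P j ≋ M j × (∀ k → P i k ≈ M i k + M j k)

  -- Restoring the last changed row of P undoes one row addition.
  det-addRows-below : ∀ t {M P : Matrix Carrier n n} → (∀ i → t ℕ.≤ toℕ i → P i ≋ M i) →
                      AddsRows M P → ∣ P ∣ ≈ ∣ M ∣
  det-addRows-below zero    unchanged _ = det-cong (λ i → unchanged i ℕ.z≤n)
  det-addRows-below {n} (suc t) {M} {P} unchanged adds with t ℕ.<? n
  ... | no t≮n = det-addRows-below t
    (λ i t≤i → contradiction (ℕ.≤-<-trans t≤i (toℕ<n i)) t≮n) adds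
  ... | yes t<n = trans step (det-addRows-below t unchanged′ adds′)
    where
    r : Fin n
    r = fromℕ< t<n

    P′ : Matrix Carrier n n
    P′ = updateAt P r (const (M r))

    P′-r : P′ r ≋ M r
    P′-r k = reflexive (≡.cong (λ row → row k) (updateAt-updates r P))

    P′-other : ∀ {i} → i ≢ r → P′ i ≋ P i
    P′-other i≢r k = reflexive (≡.cong (λ row → row k) (updateAt-minimal _ r P i≢r))

    P′-unchanged : ∀ i → P i ≋ M i → P′ i ≋ M i
    P′-unchanged i eq k with i ≟ r
    ... | yes ≡.refl = P′-r k
    ... | no  i≢r    = trans (P′-other i≢r k) (eq k)

    unchanged′ : ∀ i → t ℕ.≤ toℕ i → P′ i ≋ M i
    unchanged′ i t≤i with i ≟ r
    ... | yes ≡.refl = P′-r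
    ... | no  i≢r    = P′-unchanged i (unchanged i (ℕ.≤∧≢⇒< t≤i λ t≡i →
      i≢r (toℕ-injective (≡.trans (≡.sym t≡i) (≡.sym (toℕ-fromℕ< t<n))))))

    adds′ : AddsRows M P′
    adds′ i with i ≟ r
    ... | yes ≡.refl = inj₁ P′-r
    ... | no  i≢r with adds i
    ...   | inj₁ eq                = inj₁ (P′-unchanged i eq)
    ...   | inj₂ (j , i≢j , eqj , eqi) =
      inj₂ (j , i≢j , P′-unchanged j eqj , λ k → trans (P′-other i≢r k) (eqi k))

    step : ∣ P ∣ ≈ ∣ P′ ∣
    step with adds r
    ... | inj₁ eq = det-cong same
      where
      same : ∀ i → P i ≋ P′ i
      same i k with i ≟ r
      ... | yes ≡.refl = trans (eq k) (sym (P′-r k))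
      ... | no  i≢r    = sym (P′-other i≢r k)
    -- The added row `j` is unaltered in `P`, hence also in `P′`, so `P` arises from `P′` by this
    -- single addition.
    ... | inj₂ (j , r≢j , eqj , eqr) = det-addRow r≢j
      (λ i i≢r k → sym (P′-other i≢r k))
      (λ k → trans (eqr k) (sym (+-cong (P′-r k) (P′-unchanged j eqj k))))

  det-addRows : {M P : Matrix Carrier n n} → AddsRows M P → ∣ P ∣ ≈ ∣ M ∣
  det-addRows {n} = det-addRows-below n λ i n≤i → contradiction (toℕ<n i) (ℕ.≤⇒≯ n≤i)

  -- Carries operations on matrices indexed by `I` over to matrices indexed by `Fin n`. If row `y`
  -- is the one added, `g y` is a position where it occurs, which is what `f∘g` guarantees.
  module Reindexed {I : Set a} (f : Fin n → I) (g : I → Fin n) (f∘g : ∀ x → f (g x) ≡ x) where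

    reindex : (I → I → Carrier) → Matrix Carrier n n
    reindex M i j = M (f i) (f j)

    AddsRows-reindex : {M P : I → I → Carrier} → AddsRows M P → AddsRows (reindex M) (reindex P)
    AddsRows-reindex {M} {P} adds i with adds (f i)
    ... | inj₁ eq = inj₁ λ k → eq (f k)
    ... | inj₂ (y , fi≢y , eqy , eqi) = inj₂ (g y
      , (λ i≡gy → fi≢y (≡.trans (≡.cong f i≡gy) (f∘g y)))
      , (λ k → ≡.subst (λ z → P z (f k) ≈ M z (f k)) (≡.sym (f∘g y)) (eqy (f k)))
      , (λ k → ≡.subst (λ z → P (f i) (f k) ≈ M (f i) (f k) + M z (f k)) (≡.sym (f∘g y)) (eqi (f k))))

    det-reindex-addRows : {M P : I → I → Carrier} → AddsRows M P →
                          ∣ reindex P ∣ ≈ ∣ reindex M ∣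
    det-reindex-addRows = det-addRows ∘ AddsRows-reindex

    det-reindex-addColumns : {M P : I → I → Carrier} → AddsRows (flip M) (flip P) →
                             ∣ reindex P ∣ ≈ ∣ reindex M ∣
    det-reindex-addColumns {M} {P} adds = begin
      ∣ reindex P ∣         ≈⟨ det-transpose (reindex P) ⟨
      ∣ reindex (flip P) ∣  ≈⟨ det-reindex-addRows adds ⟩
      ∣ reindex (flip M) ∣  ≈⟨ det-transpose (reindex M) ⟩
      ∣ reindex M ∣         ∎

  -- Only the first `m` columns contribute to the expansion along row 0. Each of their minors is
  -- again block triangular, with a smaller upper block and the same lower block, whose determinant
  -- is thus a common factor.
  det-lowerTriangular : ∀ m {n} (M : Matrix Carrier (m ℕ.+ n) (m ℕ.+ n)) →
    (∀ i j → M (i ↑ˡ n) (m ↑ʳ j) ≈ 0#) →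
    ∣ M ∣ ≈ ∣ (λ i j → M (i ↑ˡ n) (j ↑ˡ n)) ∣ * ∣ (λ i j → M (m ↑ʳ i) (m ↑ʳ j)) ∣
  det-lowerTriangular zero    M _ = sym (*-identityˡ _)
  det-lowerTriangular (suc m) {n} M upper≈0 = begin
    sum t                                      ≈⟨ sum-++ (suc m) t ⟩
    sum (t ∘ (_↑ˡ n)) + sum (t ∘ (suc m ↑ʳ_))  ≈⟨ +-cong (sum-cong-≋ left) (sum-zero right) ⟩
    sum (λ j → laplaceTerm X j * ∣ W ∣) + 0#   ≈⟨ +-identityʳ _ ⟩
    sum (λ j → laplaceTerm X j * ∣ W ∣)        ≈⟨ *-distribʳ-sum ∣ W ∣ (laplaceTerm X) ⟨
    ∣ X ∣ * ∣ W ∣                              ∎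
    where
    t : Vector Carrier (suc m ℕ.+ n)
    t = laplaceTerm M
    X : Matrix Carrier (suc m) (suc m)
    X i j = M (i ↑ˡ n) (j ↑ˡ n)
    W : Matrix Carrier n n
    W i j = M (suc m ↑ʳ i) (suc m ↑ʳ j)

    right : ∀ j → t (suc m ↑ʳ j) ≈ 0#
    right j = trans (*-congˡ (trans (*-congʳ (upper≈0 zero j)) (zeroˡ _))) (zeroʳ _)

    minor-split : ∀ j → ∣ minor M (j ↑ˡ n) ∣ ≈ ∣ minor X j ∣ * ∣ W ∣
    minor-split j = trans
      (det-lowerTriangular m (minor M (j ↑ˡ n)) λ i k →
        trans (reflexive (≡.cong (M (suc (i ↑ˡ n))) (punchIn-↑ˡ-↑ʳ j k))) (upper≈0 (suc i) k))
      (*-cong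
        (det-cong λ i k → reflexive (≡.cong (M (suc (i ↑ˡ n))) (punchIn-↑ˡ-↑ˡ j k n)))
        (det-cong λ i k → reflexive (≡.cong (M (suc (m ↑ʳ i))) (punchIn-↑ˡ-↑ʳ j k))))

    left : ∀ j → t (j ↑ˡ n) ≈ laplaceTerm X j * ∣ W ∣
    left j = begin
      sign (j ↑ˡ n) * (X zero j * ∣ minor M (j ↑ˡ n) ∣)
        ≈⟨ *-cong (reflexive (≡.cong ((- 1#) ^_) (toℕ-↑ˡ j n))) (*-congˡ (minor-split j)) ⟩
      sign j * (X zero j * (∣ minor X j ∣ * ∣ W ∣))  ≈⟨ *-congˡ (*-assoc _ _ _) ⟨
      sign j * (X zero j * ∣ minor X j ∣ * ∣ W ∣)    ≈⟨ *-assoc _ _ _ ⟨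
      laplaceTerm X j * ∣ W ∣                        ∎

  -- Matrices with two twin block rows and columns

  module _ {p q} (a : Matrix Carrier p p) (b : Matrix Carrier p q) (c : Matrix Carrier q p)
           (e f : Matrix Carrier q q) where

    private
      I : Set
      I = Fin p ⊎ (Fin q ⊎ Fin q)

    twinned : I → I → Carrier
    twinned (inj₁ i)        (inj₁ j)        = a i j
    twinned (inj₁ i)        (inj₂ (inj₁ j)) = b i j
    twinned (inj₁ i)        (inj₂ (inj₂ j)) = b i j
    twinned (inj₂ (inj₁ i)) (inj₁ j)        = c i j
    twinned (inj₂ (inj₂ i)) (inj₁ j)        = c i j
    twinned (inj₂ (inj₁ i)) (inj₂ (inj₁ j)) = e i j
    twinned (inj₂ (inj₁ i)) (inj₂ (inj₂ j)) = f i j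
    twinned (inj₂ (inj₂ i)) (inj₂ (inj₁ j)) = f i j
    twinned (inj₂ (inj₂ i)) (inj₂ (inj₂ j)) = e i j

    private
      -- The matrices after the column step and after the row step. Since `AddsRows` knows only
      -- additions, the column subtraction is read backwards: `twinned` is recovered from `twinned₁`
      -- by adding the second block column to the third.
      twinned₁ twinned₂ : I → I → Carrier
      twinned₁ (inj₁ i)        (inj₂ (inj₂ j)) = 0#
      twinned₁ (inj₂ (inj₁ i)) (inj₂ (inj₂ j)) = f i j - e i j
      twinned₁ (inj₂ (inj₂ i)) (inj₂ (inj₂ j)) = e i j - f i j
      twinned₁ x               y               = twinned x y

      twinned₂ (inj₂ (inj₁ i)) (inj₁ j)        = c i j + c i j
      twinned₂ (inj₂ (inj₁ i)) (inj₂ (inj₁ j)) = e i j + f i j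
      twinned₂ (inj₂ (inj₁ i)) (inj₂ (inj₂ j)) = 0#
      twinned₂ x               y               = twinned₁ x y

      x-y+y≈x : ∀ x y → (x - y) + y ≈ x
      x-y+y≈x x y = trans (+-assoc _ _ _) (trans (+-congˡ (-‿inverseˡ y)) (+-identityʳ x))

      x-y+y-x≈0 : ∀ x y → (x - y) + (y - x) ≈ 0#
      x-y+y-x≈0 x y = begin
        (x - y) + (y - x)  ≈⟨ +-assoc _ _ _ ⟨
        (x - y) + y - x    ≈⟨ +-congʳ (x-y+y≈x x y) ⟩
        x - x              ≈⟨ -‿inverseʳ x ⟩
        0#                 ∎

      addsColumns : AddsRows (flip twinned₁) (flip twinned)
      addsColumns (inj₁ j)        = inj₁ λ { (inj₁ _) → refl ; (inj₂ (inj₁ _)) → refl ; (inj₂ (inj₂ _)) → refl }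
      addsColumns (inj₂ (inj₁ j)) = inj₁ λ { (inj₁ _) → refl ; (inj₂ (inj₁ _)) → refl ; (inj₂ (inj₂ _)) → refl }
      addsColumns (inj₂ (inj₂ j)) = inj₂ (inj₂ (inj₁ j) , (λ ())
        , (λ { (inj₁ _) → refl ; (inj₂ (inj₁ _)) → refl ; (inj₂ (inj₂ _)) → refl })
        , (λ { (inj₁ i)        → sym (+-identityˡ _)
             ; (inj₂ (inj₁ i)) → sym (x-y+y≈x _ _)
             ; (inj₂ (inj₂ i)) → sym (x-y+y≈x _ _) }))

      addsRows : AddsRows twinned₁ twinned₂
      addsRows (inj₁ i)        = inj₁ λ { (inj₁ _) → refl ; (inj₂ (inj₁ _)) → refl ; (inj₂ (inj₂ _)) → refl }
      addsRows (inj₂ (inj₁ i)) = inj₂ (inj₂ (inj₂ i) , (λ ()) , ≋-refl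
        , (λ { (inj₁ _)        → refl
             ; (inj₂ (inj₁ _)) → refl
             ; (inj₂ (inj₂ _)) → sym (x-y+y-x≈0 _ _) }))
      addsRows (inj₂ (inj₂ i)) = inj₁ ≋-refl

    -- The quotient of `twinned` in which the two rows of each twin pair are added up; both columns
    -- of a pair then carry the same entries. Adding rows is why the factor 2 falls on `c` and not
    -- on `b`.
    quotient : Fin p ⊎ Fin q → Fin p ⊎ Fin q → Carrier
    quotient (inj₁ i) (inj₁ j) = a i j
    quotient (inj₁ i) (inj₂ j) = b i j
    quotient (inj₂ i) (inj₁ j) = c i j + c i j
    quotient (inj₂ i) (inj₂ j) = e i j + f i j

    twinnedMatrix : Matrix Carrier (p ℕ.+ (q ℕ.+ q)) (p ℕ.+ (q ℕ.+ q))
    twinnedMatrix i j = twinned (split₃ p q i) (split₃ p q j)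

    quotientMatrix : Matrix Carrier (p ℕ.+ q) (p ℕ.+ q)
    quotientMatrix i j = quotient (splitAt p i) (splitAt p j)

    det-twinned : ∣ twinnedMatrix ∣ ≈ ∣ quotientMatrix ∣ * ∣ (λ i j → e i j - f i j) ∣
    det-twinned = begin
      -- Rebracketing to `(p + q) + q` turns the first two block rows into one upper block.
      ∣ twinnedMatrix ∣     ≈⟨ det-cast (ℕ.+-assoc p q q) twinnedMatrix ⟨
      ∣ (λ i j → twinned (split₃ p q (cast (ℕ.+-assoc p q q) i)) (split₃ p q (cast (ℕ.+-assoc p q q) j))) ∣
        ≈⟨ det-cong (λ i j → reflexive (≡.cong₂ twinned (split₃-cast p q i) (split₃-cast p q j))) ⟩
      ∣ reindex twinned ∣   ≈⟨ det-reindex-addColumns addsColumns ⟩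
      ∣ reindex twinned₁ ∣  ≈⟨ det-reindex-addRows addsRows ⟨
      ∣ reindex twinned₂ ∣  ≈⟨ det-lowerTriangular (p ℕ.+ q) (reindex twinned₂) upperRight ⟩
      ∣ (λ i j → reindex twinned₂ (i ↑ˡ q) (j ↑ˡ q)) ∣ *
      ∣ (λ i j → reindex twinned₂ ((p ℕ.+ q) ↑ʳ i) ((p ℕ.+ q) ↑ʳ j)) ∣
        ≈⟨ *-cong (det-cong upperLeft) (det-cong lowerRight) ⟩
      ∣ quotientMatrix ∣ * ∣ (λ i j → e i j - f i j) ∣ ∎
      where
      open Reindexed (split₃′ p q) (join₃′ p q) (split₃′-join₃′ p q)

      upperRight : ∀ i j → reindex twinned₂ (i ↑ˡ q) ((p ℕ.+ q) ↑ʳ j) ≈ 0#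
      upperRight i j rewrite splitAt-↑ˡ (p ℕ.+ q) i q | splitAt-↑ʳ (p ℕ.+ q) q j with splitAt p i
      ... | inj₁ _ = refl
      ... | inj₂ _ = refl

      upperLeft : ∀ i j → reindex twinned₂ (i ↑ˡ q) (j ↑ˡ q) ≈ quotientMatrix i j
      upperLeft i j rewrite splitAt-↑ˡ (p ℕ.+ q) i q | splitAt-↑ˡ (p ℕ.+ q) j q
        with splitAt p i | splitAt p j
      ... | inj₁ _ | inj₁ _ = refl
      ... | inj₁ _ | inj₂ _ = refl
      ... | inj₂ _ | inj₁ _ = refl
      ... | inj₂ _ | inj₂ _ = refl

      lowerRight : ∀ i j → reindex twinned₂ ((p ℕ.+ q) ↑ʳ i) ((p ℕ.+ q) ↑ʳ j) ≈ e i j - f i j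
      lowerRight i j rewrite splitAt-↑ʳ (p ℕ.+ q) q i | splitAt-↑ʳ (p ℕ.+ q) q j = refl

  module _ {q} {e f e′ f′ : Matrix Carrier q q}
           (sums : ∀ i j → e i j + f i j ≈ e′ i j + f′ i j) where

    det-quotient-cong : ∀ {p} (a : Matrix Carrier p p) b c →
                        ∣ quotientMatrix a b c e f ∣ ≈ ∣ quotientMatrix a b c e′ f′ ∣
    det-quotient-cong {p} a b c = det-cong entry
      where
      entry : ∀ i j → quotientMatrix a b c e f i j ≈ quotientMatrix a b c e′ f′ i j
      entry i j with splitAt p i | splitAt p j
      ... | inj₁ _  | inj₁ _  = refl
      ... | inj₁ _  | inj₂ _  = refl
      ... | inj₂ _  | inj₁ _  = refl
      ... | inj₂ i′ | inj₂ j′ = sums i′ j′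

    -- Exchanging the pairs `(e , f)` and `(e′ , f′)` between the two matrices leaves the quotient
    -- factors alone and only swaps the difference factors. Two sizes `p` and `p₀` let one statement
    -- serve bordered and unbordered matrices.
    det-twinned-exchange : ∀ {p p₀} (a : Matrix Carrier p p) b c (a₀ : Matrix Carrier p₀ p₀) b₀ c₀ →
      ∣ twinnedMatrix a b c e f ∣ * ∣ twinnedMatrix a₀ b₀ c₀ e′ f′ ∣ ≈
      ∣ twinnedMatrix a b c e′ f′ ∣ * ∣ twinnedMatrix a₀ b₀ c₀ e f ∣
    det-twinned-exchange a b c a₀ b₀ c₀ = begin
      ∣ twinnedMatrix a b c e f ∣ * ∣ twinnedMatrix a₀ b₀ c₀ e′ f′ ∣
        ≈⟨ *-cong (det-twinned a b c e f) (det-twinned a₀ b₀ c₀ e′ f′) ⟩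
      (Q * d) * (Q₀′ * d′)
        ≈⟨ *-cong (*-congʳ (det-quotient-cong a b c)) (*-congʳ (sym (det-quotient-cong a₀ b₀ c₀))) ⟩
      (Q′ * d) * (Q₀ * d′)
        ≈⟨ solve 4 (λ x y z w → (x :* y) :* (z :* w) := (x :* w) :* (z :* y)) refl Q′ d Q₀ d′ ⟩
      (Q′ * d′) * (Q₀ * d)
        ≈⟨ *-cong (det-twinned a b c e′ f′) (det-twinned a₀ b₀ c₀ e f) ⟨
      ∣ twinnedMatrix a b c e′ f′ ∣ * ∣ twinnedMatrix a₀ b₀ c₀ e f ∣ ∎
      where
      Q Q′ Q₀ Q₀′ d d′ : Carrier
      Q   = ∣ quotientMatrix a b c e f ∣
      Q′  = ∣ quotientMatrix a b c e′ f′ ∣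
      Q₀  = ∣ quotientMatrix a₀ b₀ c₀ e f ∣
      Q₀′ = ∣ quotientMatrix a₀ b₀ c₀ e′ f′ ∣
      d   = ∣ (λ i j → e i j - f i j) ∣
      d′  = ∣ (λ i j → e′ i j - f′ i j) ∣

-- The polynomial ring

module Polynomial {c ℓ} (R : CommutativeRing c ℓ) where
  open CommutativeRing R hiding (zero)
  open import Algebra.Properties.CommutativeSemigroup +-commutativeSemigroup
    using (interchange; x∙yz≈y∙xz)
  open import Algebra.Properties.Ring ring using (-0#≈0#)
  open import Relation.Binary.Reasoning.Setoid setoid

  open RawRing (polyRawRing rawRing) public using ()
    renaming (Carrier to P; _≈_ to _≈ₚ_; _+_ to _⊕_; _*_ to _⊗_)

  infixr 8 _·_

  _·_ : Carrier → P → P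
  x · f = map (x *_) f

  [_]_ : P → ℕ → Carrier
  [ f ] n = coeff rawRing f n

  coeff-⊕ : ∀ f g n → [ f ⊕ g ] n ≈ [ f ] n + [ g ] n
  coeff-⊕ []      g       n       = sym (+-identityˡ _)
  coeff-⊕ (x ∷ f) []      n       = sym (+-identityʳ _)
  coeff-⊕ (x ∷ f) (y ∷ g) zero    = refl
  coeff-⊕ (x ∷ f) (y ∷ g) (suc n) = coeff-⊕ f g n

  coeff-· : ∀ x f n → [ x · f ] n ≈ x * [ f ] n
  coeff-· x []      n       = sym (zeroʳ x)
  coeff-· x (y ∷ f) zero    = refl
  coeff-· x (y ∷ f) (suc n) = coeff-· x f n

  coeff-neg : ∀ f n → [ map (-_) f ] n ≈ - [ f ] n
  coeff-neg []      n       = sym -0#≈0#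
  coeff-neg (y ∷ f) zero    = refl
  coeff-neg (y ∷ f) (suc n) = coeff-neg f n

  -- This and the next recursion stand in for the convolution formula: the laws below are checked
  -- coefficient by coefficient, because equality ignores trailing zeros.
  coeff-⊗-zero : ∀ x f g → [ (x ∷ f) ⊗ g ] 0 ≈ x * [ g ] 0
  coeff-⊗-zero x f g = trans (coeff-⊕ (x · g) (0# ∷ (f ⊗ g)) 0)
    (trans (+-identityʳ _) (coeff-· x g 0))

  coeff-⊗-suc : ∀ x f g n → [ (x ∷ f) ⊗ g ] (suc n) ≈ x * [ g ] (suc n) + [ f ⊗ g ] n
  coeff-⊗-suc x f g n = trans (coeff-⊕ (x · g) (0# ∷ (f ⊗ g)) (suc n)) (+-congʳ (coeff-· x g (suc n)))

  ⊕-cong : ∀ {f f′ g g′} → f ≈ₚ f′ → g ≈ₚ g′ → (f ⊕ g) ≈ₚ (f′ ⊕ g′)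
  ⊕-cong {f} {f′} {g} {g′} f≈f′ g≈g′ n =
    trans (coeff-⊕ f g n) (trans (+-cong (f≈f′ n) (g≈g′ n)) (sym (coeff-⊕ f′ g′ n)))

  ⊕-assoc : ∀ f g h → ((f ⊕ g) ⊕ h) ≈ₚ (f ⊕ (g ⊕ h))
  ⊕-assoc f g h n = begin
    [ (f ⊕ g) ⊕ h ] n               ≈⟨ coeff-⊕ (f ⊕ g) h n ⟩
    [ f ⊕ g ] n + [ h ] n           ≈⟨ +-congʳ (coeff-⊕ f g n) ⟩
    ([ f ] n + [ g ] n) + [ h ] n   ≈⟨ +-assoc _ _ _ ⟩
    [ f ] n + ([ g ] n + [ h ] n)   ≈⟨ +-congˡ (coeff-⊕ g h n) ⟨
    [ f ] n + [ g ⊕ h ] n           ≈⟨ coeff-⊕ f (g ⊕ h) n ⟨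
    [ f ⊕ (g ⊕ h) ] n               ∎

  ⊕-comm : ∀ f g → (f ⊕ g) ≈ₚ (g ⊕ f)
  ⊕-comm f g n = trans (coeff-⊕ f g n) (trans (+-comm _ _) (sym (coeff-⊕ g f n)))

  ⊕-identityʳ : ∀ f → (f ⊕ []) ≈ₚ f
  ⊕-identityʳ f n = trans (coeff-⊕ f [] n) (+-identityʳ _)

  neg-inverseʳ : ∀ f → (f ⊕ map (-_) f) ≈ₚ []
  neg-inverseʳ f n = trans (coeff-⊕ f (map (-_) f) n)
    (trans (+-congˡ (coeff-neg f n)) (-‿inverseʳ _))

  ⊗-congˡ : ∀ f {g g′} → g ≈ₚ g′ → (f ⊗ g) ≈ₚ (f ⊗ g′)
  ⊗-congˡ []      g≈g′ n = refl
  ⊗-congˡ (x ∷ f) {g} {g′} g≈g′ zero =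
    trans (coeff-⊗-zero x f g) (trans (*-congˡ (g≈g′ 0)) (sym (coeff-⊗-zero x f g′)))
  ⊗-congˡ (x ∷ f) {g} {g′} g≈g′ (suc n) = trans (coeff-⊗-suc x f g n)
    (trans (+-cong (*-congˡ (g≈g′ (suc n))) (⊗-congˡ f g≈g′ n)) (sym (coeff-⊗-suc x f g′ n)))

  ⊗-zeroʳ : ∀ f → (f ⊗ []) ≈ₚ []
  ⊗-zeroʳ []      n       = refl
  ⊗-zeroʳ (x ∷ f) zero    = refl
  ⊗-zeroʳ (x ∷ f) (suc n) = ⊗-zeroʳ f n

  -- The mirror image of the defining clause of `⊗`, which recurses on the left factor;
  -- commutativity follows by playing one against the other.
  ⊗-∷ʳ : ∀ f y g → (f ⊗ (y ∷ g)) ≈ₚ (y · f ⊕ (0# ∷ (f ⊗ g)))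
  ⊗-∷ʳ []      y g zero    = refl
  ⊗-∷ʳ []      y g (suc n) = refl
  ⊗-∷ʳ (x ∷ f) y g zero    = +-congʳ (*-comm x y)
  ⊗-∷ʳ (x ∷ f) y g (suc n) = begin
    [ (x ∷ f) ⊗ (y ∷ g) ] (suc n)                  ≈⟨ coeff-⊗-suc x f (y ∷ g) n ⟩
    x * [ g ] n + [ f ⊗ (y ∷ g) ] n                ≈⟨ +-congˡ (⊗-∷ʳ f y g n) ⟩
    x * [ g ] n + [ y · f ⊕ (0# ∷ (f ⊗ g)) ] n     ≈⟨ +-cong (sym (coeff-· x g n)) (coeff-⊕ (y · f) (0# ∷ (f ⊗ g)) n) ⟩
    [ x · g ] n + ([ y · f ] n + [ 0# ∷ (f ⊗ g) ] n) ≈⟨ x∙yz≈y∙xz _ _ _ ⟩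
    [ y · f ] n + ([ x · g ] n + [ 0# ∷ (f ⊗ g) ] n) ≈⟨ +-congˡ (coeff-⊕ (x · g) (0# ∷ (f ⊗ g)) n) ⟨
    [ y · f ] n + [ (x ∷ f) ⊗ g ] n                ≈⟨ coeff-⊕ (y · f) ((x ∷ f) ⊗ g) n ⟨
    [ y · f ⊕ ((x ∷ f) ⊗ g) ] n                    ∎

  ⊗-comm : ∀ f g → (f ⊗ g) ≈ₚ (g ⊗ f)
  ⊗-comm []      g n = sym (⊗-zeroʳ g n)
  ⊗-comm (x ∷ f) g n = begin
    [ x · g ⊕ (0# ∷ (f ⊗ g)) ] n  ≈⟨ ⊕-cong {x · g} {x · g} {0# ∷ (f ⊗ g)} {0# ∷ (g ⊗ f)} (λ _ → refl) shifted n ⟩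
    [ x · g ⊕ (0# ∷ (g ⊗ f)) ] n  ≈⟨ ⊗-∷ʳ g x f n ⟨
    [ g ⊗ (x ∷ f) ] n             ∎
    where
    shifted : (0# ∷ (f ⊗ g)) ≈ₚ (0# ∷ (g ⊗ f))
    shifted zero    = refl
    shifted (suc n) = ⊗-comm f g n

  -- Equal polynomials can be lists of different lengths, which obstructs a joint recursion on `f`
  -- and `f′`; commutativity moves the change into the right factor.
  ⊗-congʳ : ∀ g {f f′} → f ≈ₚ f′ → (f ⊗ g) ≈ₚ (f′ ⊗ g)
  ⊗-congʳ g {f} {f′} f≈f′ n =
    trans (⊗-comm f g n) (trans (⊗-congˡ g f≈f′ n) (⊗-comm g f′ n))

  ⊗-distribˡ : ∀ f g h → (f ⊗ (g ⊕ h)) ≈ₚ (f ⊗ g ⊕ f ⊗ h)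
  ⊗-distribˡ []      g h n    = refl
  ⊗-distribˡ (x ∷ f) g h zero = begin
    [ (x ∷ f) ⊗ (g ⊕ h) ] 0                ≈⟨ coeff-⊗-zero x f (g ⊕ h) ⟩
    x * [ g ⊕ h ] 0                        ≈⟨ *-congˡ (coeff-⊕ g h 0) ⟩
    x * ([ g ] 0 + [ h ] 0)                ≈⟨ distribˡ _ _ _ ⟩
    x * [ g ] 0 + x * [ h ] 0              ≈⟨ +-cong (coeff-⊗-zero x f g) (coeff-⊗-zero x f h) ⟨
    [ (x ∷ f) ⊗ g ] 0 + [ (x ∷ f) ⊗ h ] 0  ≈⟨ coeff-⊕ ((x ∷ f) ⊗ g) ((x ∷ f) ⊗ h) 0 ⟨
    [ (x ∷ f) ⊗ g ⊕ (x ∷ f) ⊗ h ] 0        ∎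
  ⊗-distribˡ (x ∷ f) g h (suc n) = begin
    [ (x ∷ f) ⊗ (g ⊕ h) ] (suc n)                      ≈⟨ coeff-⊗-suc x f (g ⊕ h) n ⟩
    x * [ g ⊕ h ] (suc n) + [ f ⊗ (g ⊕ h) ] n          ≈⟨ +-cong (*-congˡ (coeff-⊕ g h (suc n))) (⊗-distribˡ f g h n) ⟩
    x * ([ g ] (suc n) + [ h ] (suc n)) + [ f ⊗ g ⊕ f ⊗ h ] n
      ≈⟨ +-cong (distribˡ _ _ _) (coeff-⊕ (f ⊗ g) (f ⊗ h) n) ⟩
    (x * [ g ] (suc n) + x * [ h ] (suc n)) + ([ f ⊗ g ] n + [ f ⊗ h ] n)
      ≈⟨ interchange _ _ _ _ ⟩
    (x * [ g ] (suc n) + [ f ⊗ g ] n) + (x * [ h ] (suc n) + [ f ⊗ h ] n)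
      ≈⟨ +-cong (coeff-⊗-suc x f g n) (coeff-⊗-suc x f h n) ⟨
    [ (x ∷ f) ⊗ g ] (suc n) + [ (x ∷ f) ⊗ h ] (suc n)  ≈⟨ coeff-⊕ ((x ∷ f) ⊗ g) ((x ∷ f) ⊗ h) (suc n) ⟨
    [ (x ∷ f) ⊗ g ⊕ (x ∷ f) ⊗ h ] (suc n)              ∎

  ⊗-distribʳ : ∀ h f g → ((f ⊕ g) ⊗ h) ≈ₚ (f ⊗ h ⊕ g ⊗ h)
  ⊗-distribʳ h f g n = begin
    [ (f ⊕ g) ⊗ h ] n      ≈⟨ ⊗-comm (f ⊕ g) h n ⟩
    [ h ⊗ (f ⊕ g) ] n      ≈⟨ ⊗-distribˡ h f g n ⟩
    [ h ⊗ f ⊕ h ⊗ g ] n    ≈⟨ ⊕-cong {h ⊗ f} {f ⊗ h} {h ⊗ g} {g ⊗ h} (⊗-comm h f) (⊗-comm h g) n ⟩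
    [ f ⊗ h ⊕ g ⊗ h ] n    ∎

  ·-⊗ : ∀ x f g → (x · f ⊗ g) ≈ₚ (x · (f ⊗ g))
  ·-⊗ x []      g n    = refl
  ·-⊗ x (y ∷ f) g zero = begin
    [ (x * y ∷ x · f) ⊗ g ] 0      ≈⟨ coeff-⊗-zero (x * y) (x · f) g ⟩
    (x * y) * [ g ] 0              ≈⟨ *-assoc _ _ _ ⟩
    x * (y * [ g ] 0)              ≈⟨ *-congˡ (coeff-⊗-zero y f g) ⟨
    x * [ (y ∷ f) ⊗ g ] 0          ≈⟨ coeff-· x ((y ∷ f) ⊗ g) 0 ⟨
    [ x · ((y ∷ f) ⊗ g) ] 0        ∎
  ·-⊗ x (y ∷ f) g (suc n) = begin
    [ (x * y ∷ x · f) ⊗ g ] (suc n)                    ≈⟨ coeff-⊗-suc (x * y) (x · f) g n ⟩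
    (x * y) * [ g ] (suc n) + [ x · f ⊗ g ] n          ≈⟨ +-cong (*-assoc _ _ _) (trans (·-⊗ x f g n) (coeff-· x (f ⊗ g) n)) ⟩
    x * (y * [ g ] (suc n)) + x * [ f ⊗ g ] n          ≈⟨ distribˡ _ _ _ ⟨
    x * (y * [ g ] (suc n) + [ f ⊗ g ] n)              ≈⟨ *-congˡ (coeff-⊗-suc y f g n) ⟨
    x * [ (y ∷ f) ⊗ g ] (suc n)                        ≈⟨ coeff-· x ((y ∷ f) ⊗ g) (suc n) ⟨
    [ x · ((y ∷ f) ⊗ g) ] (suc n)                      ∎

  shift-⊗ : ∀ f g → ((0# ∷ f) ⊗ g) ≈ₚ (0# ∷ (f ⊗ g))
  shift-⊗ f g zero    = trans (coeff-⊗-zero 0# f g) (zeroˡ _)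
  shift-⊗ f g (suc n) = trans (coeff-⊗-suc 0# f g n) (trans (+-congʳ (zeroˡ _)) (+-identityˡ _))

  -- The left factor is `x` plus the indeterminate times `f`; scalars and shifts both move out of a
  -- product, and distributivity joins the two parts.
  ⊗-assoc : ∀ f g h → ((f ⊗ g) ⊗ h) ≈ₚ (f ⊗ (g ⊗ h))
  ⊗-assoc []      g h n = refl
  ⊗-assoc (x ∷ f) g h n = begin
    [ (x · g ⊕ (0# ∷ (f ⊗ g))) ⊗ h ] n          ≈⟨ ⊗-distribʳ h (x · g) (0# ∷ (f ⊗ g)) n ⟩
    [ x · g ⊗ h ⊕ (0# ∷ (f ⊗ g)) ⊗ h ] n
      ≈⟨ ⊕-cong {x · g ⊗ h} {x · (g ⊗ h)} {(0# ∷ (f ⊗ g)) ⊗ h} {0# ∷ (f ⊗ (g ⊗ h))}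
           (·-⊗ x g h) shifted n ⟩
    [ x · (g ⊗ h) ⊕ (0# ∷ (f ⊗ (g ⊗ h))) ] n    ∎
    where
    shifted : ((0# ∷ (f ⊗ g)) ⊗ h) ≈ₚ (0# ∷ (f ⊗ (g ⊗ h)))
    shifted zero    = shift-⊗ (f ⊗ g) h 0
    shifted (suc n) = trans (shift-⊗ (f ⊗ g) h (suc n)) (⊗-assoc f g h n)

  ⊗-identityˡ : ∀ f → ((1# ∷ []) ⊗ f) ≈ₚ f
  ⊗-identityˡ f zero    = trans (coeff-⊗-zero 1# [] f) (*-identityˡ _)
  ⊗-identityˡ f (suc n) = trans (coeff-⊗-suc 1# [] f n) (trans (+-identityʳ _) (*-identityˡ _))

  polyCommutativeRing : CommutativeRing c ℓ
  polyCommutativeRing = record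
    { RawRing (polyRawRing rawRing)
    ; isCommutativeRing = record
      { isRing = record
        { +-isAbelianGroup = record
          { isGroup = record
            { isMonoid = record
              { isSemigroup = record
                { isMagma = record
                  { isEquivalence = record
                    { refl  = λ _ → refl
                    ; sym   = λ f≈g n → sym (f≈g n)
                    ; trans = λ f≈g g≈h n → trans (f≈g n) (g≈h n)
                    }
                  ; ∙-cong = λ {f} {f′} {g} {g′} → ⊕-cong {f} {f′} {g} {g′}
                  }
                ; assoc = ⊕-assoc
                }
              ; identity = (λ _ _ → refl) , ⊕-identityʳ
              }
            ; inverse = (λ f n → trans (⊕-comm (map (-_) f) f n) (neg-inverseʳ f n)) , neg-inverseʳ
            ; ⁻¹-cong = λ {f} {g} f≈g n →
                trans (coeff-neg f n) (trans (-‿cong (f≈g n)) (sym (coeff-neg g n)))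
            }
          ; comm = ⊕-comm
          }
        ; *-cong = λ {f} {f′} {g} {g′} f≈f′ g≈g′ n →
            trans (⊗-congʳ g {f} {f′} f≈f′ n) (⊗-congˡ f′ {g} {g′} g≈g′ n)
        ; *-assoc = ⊗-assoc
        ; *-identity = ⊗-identityˡ , λ f n → trans (⊗-comm f (1# ∷ []) n) (⊗-identityˡ f n)
        ; distrib = ⊗-distribˡ , ⊗-distribʳ
        }
      ; *-comm = ⊗-comm
      }
    }

-- Characteristic polynomials

-- `charMatrix` tests equality of whole indices, whereas `block` looks at split ones. With the test
-- moved to the split indices, the diagonal becomes visible block by block.
does-≟-splitAt : ∀ m {n} (i j : Fin (m ℕ.+ n)) →
  does (i ≟ j) ≡ does (≡-dec _≟_ _≟_ (splitAt m i) (splitAt m j))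
does-≟-splitAt m {n} i j = does-⇔
  (mk⇔ (≡.cong (splitAt m)) splitAt-injective) (i ≟ j) (≡-dec _≟_ _≟_ (splitAt m i) (splitAt m j))
  where
  splitAt-injective : splitAt m i ≡ splitAt m j → i ≡ j
  splitAt-injective eq = begin
    i                       ≡⟨ join-splitAt m n i ⟨
    join m n (splitAt m i)  ≡⟨ ≡.cong (join m n) eq ⟩
    join m n (splitAt m j)  ≡⟨ join-splitAt m n j ⟩
    j                       ∎
    where open ≡.≡-Reasoning

module CharacteristicPolynomial {a c ℓ} (R : CommutativeRing c ℓ) {A : Set a}
                                (φ : A → CommutativeRing.Carrier R) where
  private
    module R = CommutativeRing R
  open Polynomial R using (polyCommutativeRing)
  open CommutativeRing polyCommutativeRing hiding (zero)
  open Determinant polyCommutativeRing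
  open import Algebra.Properties.Ring R.ring using (-0#≈0#; -‿+-comm)
  open import Relation.Binary.Reasoning.Setoid setoid

  χMatrix : ∀ {n} → Matrix A n n → Matrix Carrier n n
  χMatrix M = charMatrix R.rawRing (λ i j → φ (M i j))

  χ : ∀ {n} → Matrix A n n → Carrier
  χ M = charPoly R.rawRing (λ i j → φ (M i j))

  -- Away from the diagonal, `charMatrix` reduces definitionally to these constant polynomials; here
  -- they also form rectangular blocks.
  offDiagonal : ∀ {m n} → Matrix A m n → Matrix Carrier m n
  offDiagonal M i j = R.- φ (M i j) ∷ []

  -- The zero blocks consist of some `z` in `A`, since the zero of the base field is sent to zero
  -- only up to the equality of the extension.
  χ-directSum : ∀ {z} → φ z R.≈ R.0# → ∀ {m n} (X : Matrix A m m) (Y : Matrix A n n) →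
                χ (block X (λ _ _ → z) (λ _ _ → z) Y) ≈ χ X * χ Y
  χ-directSum {z} φz≈0 {m} {n} X Y = begin
    ∣ χMatrix M ∣
      ≈⟨ det-lowerTriangular m (χMatrix M) upperRight ⟩
    ∣ (λ i j → χMatrix M (i ↑ˡ n) (j ↑ˡ n)) ∣ * ∣ (λ i j → χMatrix M (m ↑ʳ i) (m ↑ʳ j)) ∣
      ≈⟨ *-cong {∣ (λ i j → χMatrix M (i ↑ˡ n) (j ↑ˡ n)) ∣} {χ X}
                {∣ (λ i j → χMatrix M (m ↑ʳ i) (m ↑ʳ j)) ∣} {χ Y}
           (det-cong λ i j → reflexive (upperLeft i j)) (det-cong λ i j → reflexive (lowerRight i j)) ⟩
    χ X * χ Y ∎
    where
    M : Matrix A (m ℕ.+ n) (m ℕ.+ n)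
    M = block X (λ _ _ → z) (λ _ _ → z) Y

    upperRight : ∀ i j → χMatrix M (i ↑ˡ n) (m ↑ʳ j) ≈ 0#
    upperRight i j rewrite does-≟-splitAt m (i ↑ˡ n) (m ↑ʳ j) | splitAt-↑ˡ m i n | splitAt-↑ʳ m n j =
      λ { zero → R.trans (R.-‿cong φz≈0) -0#≈0# ; (suc _) → R.refl }

    upperLeft : ∀ i j → χMatrix M (i ↑ˡ n) (j ↑ˡ n) ≡ χMatrix X i j
    upperLeft i j rewrite does-≟-splitAt m (i ↑ˡ n) (j ↑ˡ n) | splitAt-↑ˡ m i n | splitAt-↑ˡ m j n = ≡.refl

    lowerRight : ∀ i j → χMatrix M (m ↑ʳ i) (m ↑ʳ j) ≡ χMatrix Y i j
    lowerRight i j rewrite does-≟-splitAt m (m ↑ʳ i) (m ↑ʳ j) | splitAt-↑ʳ m n i | splitAt-↑ʳ m n j = ≡.refl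

  twin : ∀ {p q} → Matrix A p p → Matrix A p q → Matrix A q p → Matrix A q q → Matrix A q q →
         Matrix A (p ℕ.+ (q ℕ.+ q)) (p ℕ.+ (q ℕ.+ q))
  twin X B C E F = block X (λ i → B i ++ B i) (C ++ C) (block E F F E)

  -- The indeterminate X sits only in diagonal blocks, so the twin shape survives with `e` equal to
  -- X - E and `f` equal to the constant - F.
  χTwin : ∀ {p q} → Matrix A p p → Matrix A p q → Matrix A q p → Matrix A q q → Matrix A q q →
          Matrix Carrier (p ℕ.+ (q ℕ.+ q)) (p ℕ.+ (q ℕ.+ q))
  χTwin X B C E F =
    twinnedMatrix (χMatrix X) (offDiagonal B) (offDiagonal C) (χMatrix E) (offDiagonal F)

  χMatrix-twin : ∀ {p q} (X : Matrix A p p) (B : Matrix A p q) (C : Matrix A q p) E F i j →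
                 χMatrix (twin X B C E F) i j ≡ χTwin X B C E F i j
  χMatrix-twin {p} {q} X B C E F i j rewrite does-≟-splitAt p i j with splitAt p i
  χMatrix-twin {p} {q} X B C E F i j | inj₁ _ with splitAt p j
  ... | inj₁ _ = ≡.refl
  ... | inj₂ j′ with splitAt q j′
  ...   | inj₁ _ = ≡.refl
  ...   | inj₂ _ = ≡.refl
  χMatrix-twin {p} {q} X B C E F i j | inj₂ i′ with splitAt p j
  χMatrix-twin {p} {q} X B C E F i j | inj₂ i′ | inj₁ _ with splitAt q i′
  ... | inj₁ _ = ≡.refl
  ... | inj₂ _ = ≡.refl
  -- Only when both indices lie in the twin part must the diagonal test be split a second time, to
  -- tell the two copies apart.
  χMatrix-twin {p} {q} X B C E F i j | inj₂ i′ | inj₂ j′ rewrite does-≟-splitAt q i′ j′ with splitAt q i′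
  χMatrix-twin {p} {q} X B C E F i j | inj₂ i′ | inj₂ j′ | inj₁ _ with splitAt q j′
  ... | inj₁ _ = ≡.refl
  ... | inj₂ _ = ≡.refl
  χMatrix-twin {p} {q} X B C E F i j | inj₂ i′ | inj₂ j′ | inj₂ _ with splitAt q j′
  ... | inj₁ _ = ≡.refl
  ... | inj₂ _ = ≡.refl

  χ-twin : ∀ {p q} (X : Matrix A p p) (B : Matrix A p q) (C : Matrix A q p) E F →
           χ (twin X B C E F) ≈ ∣ χTwin X B C E F ∣
  χ-twin X B C E F = det-cong {M = χMatrix (twin X B C E F)} {χTwin X B C E F}
    λ i j → reflexive (χMatrix-twin X B C E F i j)

  module _ {q} {E F E′ F′ : Matrix A q q}
           (sums : ∀ i j → φ (E i j) R.+ φ (F i j) R.≈ φ (E′ i j) R.+ φ (F′ i j)) where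

    χMatrix-sum : ∀ i j → χMatrix E i j + offDiagonal F i j ≈ χMatrix E′ i j + offDiagonal F′ i j
    χMatrix-sum i j = begin
      (δ + offDiagonal E i j) + offDiagonal F i j    ≈⟨ +-assoc δ (offDiagonal E i j) (offDiagonal F i j) ⟩
      δ + (offDiagonal E i j + offDiagonal F i j)    ≈⟨ +-cong {δ} {δ} {offDiagonal E i j + offDiagonal F i j}
                                                          {offDiagonal E′ i j + offDiagonal F′ i j}
                                                          (λ _ → R.refl) constants ⟩
      δ + (offDiagonal E′ i j + offDiagonal F′ i j)  ≈⟨ +-assoc δ (offDiagonal E′ i j) (offDiagonal F′ i j) ⟨
      (δ + offDiagonal E′ i j) + offDiagonal F′ i j  ∎
      where
      δ : Carrier
      δ = if does (i ≟ j) then R.0# ∷ R.1# ∷ [] else []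

      constants : offDiagonal E i j + offDiagonal F i j ≈ offDiagonal E′ i j + offDiagonal F′ i j
      constants zero    = R.trans (-‿+-comm _ _) (R.trans (R.-‿cong (sums i j)) (R.sym (-‿+-comm _ _)))
      constants (suc _) = R.refl

    χ-twin-exchange : ∀ {p p₀} (X : Matrix A p p) B C (X₀ : Matrix A p₀ p₀) B₀ C₀ →
      χ (twin X B C E F) * χ (twin X₀ B₀ C₀ E′ F′) ≈ χ (twin X B C E′ F′) * χ (twin X₀ B₀ C₀ E F)
    χ-twin-exchange X B C X₀ B₀ C₀ = begin
      χ (twin X B C E F) * χ (twin X₀ B₀ C₀ E′ F′)
        ≈⟨ *-cong {χ (twin X B C E F)} {∣ χTwin X B C E F ∣}
                  {χ (twin X₀ B₀ C₀ E′ F′)} {∣ χTwin X₀ B₀ C₀ E′ F′ ∣}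
                  (χ-twin X B C E F) (χ-twin X₀ B₀ C₀ E′ F′) ⟩
      ∣ χTwin X B C E F ∣ * ∣ χTwin X₀ B₀ C₀ E′ F′ ∣
        ≈⟨ det-twinned-exchange χMatrix-sum
             (χMatrix X) (offDiagonal B) (offDiagonal C) (χMatrix X₀) (offDiagonal B₀) (offDiagonal C₀) ⟩
      ∣ χTwin X B C E′ F′ ∣ * ∣ χTwin X₀ B₀ C₀ E F ∣
        ≈⟨ *-cong {χ (twin X B C E′ F′)} {∣ χTwin X B C E′ F′ ∣}
                  {χ (twin X₀ B₀ C₀ E F)} {∣ χTwin X₀ B₀ C₀ E F ∣}
                  (χ-twin X B C E′ F′) (χ-twin X₀ B₀ C₀ E F) ⟨
      χ (twin X B C E′ F′) * χ (twin X₀ B₀ C₀ E F) ∎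

theorem3p18 : ∀ {c ℓ₁ ℓ₂ : Level} (K : HeytingField c ℓ₁ ℓ₂) →
    let open HeytingField K
        R = fieldRawRing K
    in
    (p q : ℕ) (B : Matrix Carrier p q) (G : Matrix Carrier q q) (G′ : Matrix Carrier p p)
    (E F : Matrix Carrier q q) →
    Symmetric R G → Symmetric R G′ → Symmetric R E → Symmetric R F →
    (∀ i j → E i j + F i j ≈ G i j) →
    let O : Matrix Carrier q q
        O = zeroMatrix R
        B∣B = λ i → B i ++ B i
        Bᵀ/Bᵀ = transpose B ++ transpose B
        A = block G′ B∣B Bᵀ/Bᵀ (block O G G O)
        D = block G′ B∣B Bᵀ/Bᵀ (block E F F E)
    in
    Cospectral K (directSum R A (block E F F E)) (directSum R D (block O G G O))
theorem3p18 K p q B G G′ E F _ _ _ _ E+F≈G L φ isHom μ k = mk⇔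
  -- Since the characteristic polynomials agree, the same cofactor `g` witnesses the multiplicity on
  -- both sides.
  (λ { (g , χ≈ , g≉0) → g , (λ n → R.trans (R.sym (charPolys n)) (χ≈ n)) , g≉0 })
  (λ { (g , χ≈ , g≉0) → g , (λ n → R.trans (charPolys n) (χ≈ n)) , g≉0 })
  where
  module K = HeytingField K
  R = HeytingCommutativeRing.commutativeRing (HeytingField.heytingCommutativeRing L)
  module R = CommutativeRing R
  module P = CommutativeRing (Polynomial.polyCommutativeRing R)
  open RingMorphisms.IsRingHomomorphism isHom using (+-homo; 0#-homo; ⟦⟧-cong)
  open CharacteristicPolynomial R φ

  O : Matrix K.Carrier q q
  O = zeroMatrix (fieldRawRing K)

  sums : ∀ i j → φ (O i j) R.+ φ (G i j) R.≈ φ (E i j) R.+ φ (F i j)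
  sums i j = begin
    φ K.0# R.+ φ (G i j)     ≈⟨ R.+-congʳ 0#-homo ⟩
    R.0# R.+ φ (G i j)       ≈⟨ R.+-identityˡ _ ⟩
    φ (G i j)                ≈⟨ ⟦⟧-cong (E+F≈G i j) ⟨
    φ (E i j K.+ F i j)      ≈⟨ +-homo (E i j) (F i j) ⟩
    φ (E i j) R.+ φ (F i j)  ∎
    where open import Relation.Binary.Reasoning.Setoid R.setoid

  Bᵀ : Matrix K.Carrier q p
  Bᵀ = transpose B

  charPolys : χ (directSum (fieldRawRing K) (twin G′ B Bᵀ O G) (block E F F E)) P.≈
              χ (directSum (fieldRawRing K) (twin G′ B Bᵀ E F) (block O G G O))
  -- For p = 0 the matrix twin X B C E F is definitionally block E F F E.
  charPolys = begin
    χ (directSum (fieldRawRing K) (twin G′ B Bᵀ O G) (block E F F E))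
      ≈⟨ χ-directSum 0#-homo (twin G′ B Bᵀ O G) (block E F F E) ⟩
    χ (twin G′ B Bᵀ O G) P.* χ (block E F F E)
      ≈⟨ χ-twin-exchange {E = O} {G} {E} {F} sums {p₀ = 0} G′ B Bᵀ (λ ()) (λ ()) (λ _ ()) ⟩
    χ (twin G′ B Bᵀ E F) P.* χ (block O G G O)
      ≈⟨ χ-directSum 0#-homo (twin G′ B Bᵀ E F) (block O G G O) ⟨
    χ (directSum (fieldRawRing K) (twin G′ B Bᵀ E F) (block O G G O)) ∎
    where open import Relation.Binary.Reasoning.Setoid P.setoid
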